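{- The logic $$\mathrm{RC_1^{i2}}=\mathrm{RmbC}(\mathrm{cf},i2,\mathrm{ca}_\wedge,\mathrm{ca}_\vee,\mathrm{ca}_\to,\mathrm{a}_\circ,\mathrm{a}_\neg)$$ is paraconsistent, i.e. there are formulas $\varphi,\psi$ such that $\varphi,\neg\varphi\nvdash_{\mathrm{RC_1^{i2}}}\psi$.
   Context: Formulas are built from a countably infinite set of propositional variables using binary $\wedge,\vee,\to$ and unary $\neg,\circ$; $\alpha\leftrightarrow\beta$ abbreviates $(\alpha\to\beta)\wedge(\beta\to\alpha)$. The logic $\mathrm{RmbC}$ is given by the Hilbert calculus with axiom schemas $\alpha\to(\beta\to\alpha)$; $(\alpha\to(\beta\to\gamma))\to((\alpha\to\beta)\to(\alpha\to\gamma))$; $\alpha\to(\beta\to(\alpha\wedge\beta))$; $(\alpha\wedge\beta)\to\alpha$; $(\alpha\wedge\beta)\to\beta$; $\alpha\to(\alpha\vee\beta)$; $\beta\to(\alpha\vee\beta)$; $(\alpha\to\gamma)\to((\beta\to\gamma)\to((\alpha\vee\beta)\to\gamma))$; $(\alpha\to\beta)\vee\alpha$; $\alpha\vee\neg\alpha$; $\circ\alpha\to(\alpha\to(\neg\alpha\to\beta))$; and inference rules: modus ponens (from $\alpha$ and $\alpha\to\beta$ infer $\beta$); $(R_\neg)$: from $\alpha\leftrightarrow\psi$ infer $\neg\alpha\leftrightarrow\neg\psi$; $(R_\circ)$: from $\alpha\leftrightarrow\psi$ infer $\circ\alpha\leftrightarrow\circ\psi$. Theorems are the formulas derivable in this calculus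 (without premises). For a set $Ax$ of axiom schemas, $\mathrm{RmbC}(Ax)$ is obtained by adding the schemas in $Ax$ to the calculus. Here: - $(\mathrm{cf})$: $\neg\neg\alpha\to\alpha$; - $(i2)$: $\neg{\circ}\alpha\to\neg\alpha$; - $(\mathrm{ca}_\#)$, for $\#\in\{\wedge,\vee,\to\}$: $(\circ\alpha\wedge\circ\beta)\to\circ(\alpha\#\beta)$; - $(\mathrm{a}_\circ)$: $\circ{\circ}\alpha$; - $(\mathrm{a}_\neg)$: $\circ\alpha\to\circ\neg\alpha$. Derivability from premises is local: for such a logic $L$, $\Gamma\vdash_L\varphi$ means that either $\varphi$ is a theorem of $L$, or there is a finite non-empty subset $\{\gamma_1,\dots,\gamma_n\}\subseteq\Gamma$ such that $(\gamma_1\wedge\cdots\wedge\gamma_n)\to\varphi$ is a theorem of $L$. -}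

module Defs where

open import Data.List.NonEmpty using (List⁺; foldr₁)
open import Data.List.NonEmpty.Relation.Unary.All using (All)
open import Data.Nat using (ℕ)
open import Data.Product using (_×_; ∃-syntax; ∃₂)
open import Data.Sum using (_⊎_)
open import Level using (0ℓ)
open import Relation.Nullary using (¬_)
open import Relation.Unary using (Pred; _∈_; _∪_; ｛_｝)

infix  9 ¬ᶠ_ ∘_
infixr 7 _∧_
infixr 6 _∨_
infixr 5 _⇒_
infix  4 _⇔_

-- ¬ᶠ is the object-language negation; ¬ is reserved for the metalanguage.
data Formula : Set where
  var         : ℕ → Formula
  _∧_ _∨_ _⇒_ : Formula → Formula → Formula
  ¬ᶠ_ ∘_      : Formula → Formula

_⇔_ : Formula → Formula → Formula
α ⇔ β = (α ⇒ β) ∧ (β ⇒ α)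

-- An axiom schema, or a set of axiom schemas, is represented by the set of
-- all its instances, so that adding several schemas is taking a union.
Schema : Set₁
Schema = Pred Formula 0ℓ

-- A logic is represented by its set of theorems.
Logic : Set₁
Logic = Pred Formula 0ℓ

-- R¬ and R∘ apply to theorems only: the calculus has no premises.
data RmbC (Ax : Schema) : Logic where
  K    : ∀ α β   → RmbC Ax (α ⇒ (β ⇒ α))
  S    : ∀ α β γ → RmbC Ax ((α ⇒ (β ⇒ γ)) ⇒ ((α ⇒ β) ⇒ (α ⇒ γ)))
  ∧I   : ∀ α β   → RmbC Ax (α ⇒ (β ⇒ (α ∧ β)))
  ∧E₁  : ∀ α β   → RmbC Ax ((α ∧ β) ⇒ α)
  ∧E₂  : ∀ α β   → RmbC Ax ((α ∧ β) ⇒ β)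
  ∨I₁  : ∀ α β   → RmbC Ax (α ⇒ (α ∨ β))
  ∨I₂  : ∀ α β   → RmbC Ax (β ⇒ (α ∨ β))
  ∨E   : ∀ α β γ → RmbC Ax ((α ⇒ γ) ⇒ ((β ⇒ γ) ⇒ ((α ∨ β) ⇒ γ)))
  ⇒∨   : ∀ α β   → RmbC Ax ((α ⇒ β) ∨ α)
  em   : ∀ α     → RmbC Ax (α ∨ (¬ᶠ α))
  bc   : ∀ α β   → RmbC Ax ((∘ α) ⇒ (α ⇒ ((¬ᶠ α) ⇒ β)))
  ax   : ∀ {α}   → α ∈ Ax → RmbC Ax α
  MP   : ∀ {α β} → RmbC Ax α → RmbC Ax (α ⇒ β) → RmbC Ax β
  R¬   : ∀ {α ψ} → RmbC Ax (α ⇔ ψ) → RmbC Ax ((¬ᶠ α) ⇔ (¬ᶠ ψ))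
  R∘   : ∀ {α ψ} → RmbC Ax (α ⇔ ψ) → RmbC Ax ((∘ α) ⇔ (∘ ψ))

data cf : Schema where
  inst : ∀ α → cf ((¬ᶠ (¬ᶠ α)) ⇒ α)

data i2 : Schema where
  inst : ∀ α → i2 ((¬ᶠ (∘ α)) ⇒ (¬ᶠ α))

data ca (_#_ : Formula → Formula → Formula) : Schema where
  inst : ∀ α β → ca _#_ (((∘ α) ∧ (∘ β)) ⇒ (∘ (α # β)))

data a∘ : Schema where
  inst : ∀ α → a∘ (∘ (∘ α))

data a¬ : Schema where
  inst : ∀ α → a¬ ((∘ α) ⇒ (∘ (¬ᶠ α)))

RC₁ⁱ² : Logic
RC₁ⁱ² = RmbC (cf ∪ i2 ∪ ca _∧_ ∪ ca _∨_ ∪ ca _⇒_ ∪ a∘ ∪ a¬)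

⋀ : List⁺ Formula → Formula
⋀ = foldr₁ _∧_

-- Γ ⊢[ L ] φ is local derivability. A finite non-empty subset of Γ is given
-- by a non-empty list enumerating it, possibly with repetitions.
infix 3 _⊢[_]_

_⊢[_]_ : Pred Formula 0ℓ → Logic → Formula → Set
Γ ⊢[ L ] φ = φ ∈ L ⊎ (∃[ γs ] All (_∈ Γ) γs × (⋀ γs ⇒ φ) ∈ L)

Paraconsistent : Logic → Set
Paraconsistent L = ∃₂ λ φ ψ → ¬ (｛ φ ｝ ∪ ｛ ¬ᶠ φ ｝ ⊢[ L ] ψ)

{-# OPTIONS --safe #-}

-- Soundness for one valuation in the four-element Boolean algebra, expanded by
-- operators for ∘ and ¬.  Axioms em, bc, i2 and a∘ force ¬x = ∼(x ⊓ ∘x), so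
-- only ∘ has to be chosen: it is ⊤ on the constants {⊥, ⊤}, a subalgebra, and ⊥ on
-- the two atoms.  For an atom p this gives ¬p = ⊤, so p ⊓ ¬p = p is not ⊥.
module Submission where

open import Defs
open import Data.Bool as Bool using (Bool; true; false; not; _xor_)
open import Data.List using ([]; _∷_)
open import Data.List.NonEmpty using (List⁺; _∷_)
open import Data.List.NonEmpty.Relation.Unary.All using (All; _∷_)
open import Data.List.Relation.Unary.All as List using ([]; _∷_)
open import Data.Product using (_×_; _,_; curry; proj₁; map; uncurry; zip)
open import Data.Product.Properties using (≡-dec)
open import Data.Sum using (inj₁; inj₂)
open import Level using (Level)
open import Relation.Binary.Definitions using (DecidableEquality)
open import Relation.Binary.PropositionalEquality
  using (_≡_; refl; trans; sym; cong; cong₂)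
open import Relation.Nullary using (Dec; ¬_)
open import Relation.Nullary.Decidable using (map′; from-yes; _×-dec_; _→-dec_)
open import Relation.Unary using (Pred; Decidable; _∈_; _∪_; ｛_｝)

private variable
  ℓ : Level

B : Set
B = Bool × Bool

infixr 7 _⊓_
infixr 6 _⊔_
infixr 5 _⇛_
infix  5 _⇚⇛_
infix  4 _≟_

⊤ p : B
⊤ = true , true
p = true , false

_⊓_ _⊔_ _⇛_ _⇚⇛_ : B → B → B
_⊓_ = zip Bool._∧_ Bool._∧_
_⊔_ = zip Bool._∨_ Bool._∨_
x ⇛ y = map not not x ⊔ y
x ⇚⇛ y = (x ⇛ y) ⊓ (y ⇛ x)

circ neg : B → B
circ (a , b) = not (a xor b) , not (a xor b)
neg x = map not not (x ⊓ circ x)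

_≟_ : DecidableEquality B
_≟_ = ≡-dec Bool._≟_ Bool._≟_

∀Bool? : {P : Pred Bool ℓ} → Decidable P → Dec (∀ b → P b)
∀Bool? P? = map′ (λ { (f , t) → λ { false → f ; true → t } })
                 (λ h → h false , h true)
                 (P? false ×-dec P? true)

∀B? : {P : Pred B ℓ} → Decidable P → Dec (∀ x → P x)
∀B? P? = map′ uncurry curry (∀Bool? λ a → ∀Bool? λ b → P? (a , b))

-- The algebra is finite, so validity of an equation is decided by evaluation; `from-yes` then
-- extracts the proof during type checking.
valid₁ : (f : B → B) → Dec (∀ x → f x ≡ ⊤)
valid₁ f = ∀B? λ x → f x ≟ ⊤

valid₂ : (f : B → B → B) → Dec (∀ x y → f x y ≡ ⊤)
valid₂ f = ∀B? λ x → valid₁ (f x)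

valid₃ : (f : B → B → B → B) → Dec (∀ x y z → f x y z ≡ ⊤)
valid₃ f = ∀B? λ x → valid₂ (f x)

⇛-mp : ∀ {x y} → x ≡ ⊤ → x ⇛ y ≡ ⊤ → y ≡ ⊤
⇛-mp refl x⇛y = x⇛y

-- Antisymmetry of the Boolean order, as `x ⇛ y` is `⊤` exactly when x lies below y. It makes `R¬`
-- and `R∘` sound for any choice of operators.
⇚⇛⇒≡ : ∀ x y → x ⇚⇛ y ≡ ⊤ → x ≡ y
⇚⇛⇒≡ = from-yes (∀B? λ x → ∀B? λ y → (x ⇚⇛ y ≟ ⊤) →-dec (x ≟ y))

⇚⇛-refl : ∀ x → x ⇚⇛ x ≡ ⊤
⇚⇛-refl = from-yes (valid₁ λ x → x ⇚⇛ x)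

⇚⇛-cong : (f : B → B) → ∀ x y → x ⇚⇛ y ≡ ⊤ → f x ⇚⇛ f y ≡ ⊤
⇚⇛-cong f x y eq =
  trans (cong (λ z → f x ⇚⇛ f z) (sym (⇚⇛⇒≡ x y eq))) (⇚⇛-refl (f x))

-- One valuation suffices to refute a consequence; an atom is the only kind of value at which a
-- contradiction is not `⊥`.
⟦_⟧ : Formula → B
⟦ var _ ⟧ = p
⟦ α ∧ β ⟧ = ⟦ α ⟧ ⊓ ⟦ β ⟧
⟦ α ∨ β ⟧ = ⟦ α ⟧ ⊔ ⟦ β ⟧
⟦ α ⇒ β ⟧ = ⟦ α ⟧ ⇛ ⟦ β ⟧
⟦ ¬ᶠ α ⟧  = neg ⟦ α ⟧
⟦ ∘ α ⟧   = circ ⟦ α ⟧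

RmbC-sound : ∀ {Ax} → (∀ {α} → α ∈ Ax → ⟦ α ⟧ ≡ ⊤) →
             ∀ {α} → α ∈ RmbC Ax → ⟦ α ⟧ ≡ ⊤
RmbC-sound Ax⊨ (K α β) =
  from-yes (valid₂ λ x y → x ⇛ y ⇛ x) ⟦ α ⟧ ⟦ β ⟧
RmbC-sound Ax⊨ (S α β γ) =
  from-yes (valid₃ λ x y z → (x ⇛ y ⇛ z) ⇛ (x ⇛ y) ⇛ x ⇛ z) ⟦ α ⟧ ⟦ β ⟧ ⟦ γ ⟧
RmbC-sound Ax⊨ (∧I α β) =
  from-yes (valid₂ λ x y → x ⇛ y ⇛ x ⊓ y) ⟦ α ⟧ ⟦ β ⟧
RmbC-sound Ax⊨ (∧E₁ α β) =
  from-yes (valid₂ λ x y → x ⊓ y ⇛ x) ⟦ α ⟧ ⟦ β ⟧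
RmbC-sound Ax⊨ (∧E₂ α β) =
  from-yes (valid₂ λ x y → x ⊓ y ⇛ y) ⟦ α ⟧ ⟦ β ⟧
RmbC-sound Ax⊨ (∨I₁ α β) =
  from-yes (valid₂ λ x y → x ⇛ x ⊔ y) ⟦ α ⟧ ⟦ β ⟧
RmbC-sound Ax⊨ (∨I₂ α β) =
  from-yes (valid₂ λ x y → y ⇛ x ⊔ y) ⟦ α ⟧ ⟦ β ⟧
RmbC-sound Ax⊨ (∨E α β γ) =
  from-yes (valid₃ λ x y z → (x ⇛ z) ⇛ (y ⇛ z) ⇛ x ⊔ y ⇛ z) ⟦ α ⟧ ⟦ β ⟧ ⟦ γ ⟧
RmbC-sound Ax⊨ (⇒∨ α β) =
  from-yes (valid₂ λ x y → (x ⇛ y) ⊔ x) ⟦ α ⟧ ⟦ β ⟧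
RmbC-sound Ax⊨ (em α) =
  from-yes (valid₁ λ x → x ⊔ neg x) ⟦ α ⟧
RmbC-sound Ax⊨ (bc α β) =
  from-yes (valid₂ λ x y → circ x ⇛ x ⇛ neg x ⇛ y) ⟦ α ⟧ ⟦ β ⟧
RmbC-sound Ax⊨ (ax α∈Ax) = Ax⊨ α∈Ax
RmbC-sound Ax⊨ (MP ⊢α ⊢α⇒β) = ⇛-mp (RmbC-sound Ax⊨ ⊢α) (RmbC-sound Ax⊨ ⊢α⇒β)
RmbC-sound Ax⊨ (R¬ {α} {ψ} ⊢α⇔ψ) =
  ⇚⇛-cong neg ⟦ α ⟧ ⟦ ψ ⟧ (RmbC-sound Ax⊨ ⊢α⇔ψ)
RmbC-sound Ax⊨ (R∘ {α} {ψ} ⊢α⇔ψ) =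
  ⇚⇛-cong circ ⟦ α ⟧ ⟦ ψ ⟧ (RmbC-sound Ax⊨ ⊢α⇔ψ)

axioms-valid : ∀ {α} → α ∈ cf ∪ i2 ∪ ca _∧_ ∪ ca _∨_ ∪ ca _⇒_ ∪ a∘ ∪ a¬ → ⟦ α ⟧ ≡ ⊤
-- On the constants `neg` is the involutive complement; an atom is sent to `⊤` and then to the
-- bottom element.
axioms-valid (inj₁ (inst α)) =
  from-yes (valid₁ λ x → neg (neg x) ⇛ x) ⟦ α ⟧
axioms-valid (inj₂ (inj₁ (inst α))) =
  from-yes (valid₁ λ x → neg (circ x) ⇛ neg x) ⟦ α ⟧
axioms-valid (inj₂ (inj₂ (inj₁ (inst α β)))) =
  from-yes (valid₂ λ x y → circ x ⊓ circ y ⇛ circ (x ⊓ y)) ⟦ α ⟧ ⟦ β ⟧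
axioms-valid (inj₂ (inj₂ (inj₂ (inj₁ (inst α β))))) =
  from-yes (valid₂ λ x y → circ x ⊓ circ y ⇛ circ (x ⊔ y)) ⟦ α ⟧ ⟦ β ⟧
axioms-valid (inj₂ (inj₂ (inj₂ (inj₂ (inj₁ (inst α β)))))) =
  from-yes (valid₂ λ x y → circ x ⊓ circ y ⇛ circ (x ⇛ y)) ⟦ α ⟧ ⟦ β ⟧
axioms-valid (inj₂ (inj₂ (inj₂ (inj₂ (inj₂ (inj₁ (inst α))))))) =
  from-yes (valid₁ λ x → circ (circ x)) ⟦ α ⟧
axioms-valid (inj₂ (inj₂ (inj₂ (inj₂ (inj₂ (inj₂ (inst α))))))) =
  from-yes (valid₁ λ x → circ x ⇛ circ (neg x)) ⟦ α ⟧

RC₁ⁱ²-sound : ∀ {α} → α ∈ RC₁ⁱ² → ⟦ α ⟧ ≡ ⊤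
RC₁ⁱ²-sound = RmbC-sound axioms-valid

-- The first coordinate is membership in the ultrafilter generated by p.
Holds : Pred Formula _
Holds α = proj₁ ⟦ α ⟧ ≡ true

-- The premise `var 0` has value `p`, not `⊤`, so premises are followed through the ultrafilter,
-- which is closed under meets.
⋀-holds : ∀ {Γ : Schema} → (∀ {γ} → γ ∈ Γ → Holds γ) →
          (γs : List⁺ Formula) → All (_∈ Γ) γs → Holds (⋀ γs)
⋀-holds {Γ} Γ⊨ (γ ∷ γs) (γ∈Γ ∷ γs∈Γ) = go γ γs γ∈Γ γs∈Γ
  where
  go : ∀ γ γs → γ ∈ Γ → List.All (_∈ Γ) γs → Holds (⋀ (γ ∷ γs))
  go γ []       γ∈Γ []             = Γ⊨ γ∈Γ
  go γ (δ ∷ δs) γ∈Γ (δ∈Γ ∷ δs∈Γ) = cong₂ Bool._∧_ (Γ⊨ γ∈Γ) (go δ δs δ∈Γ δs∈Γ)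

⇒-holds : ∀ α β → Holds α → Holds (α ⇒ β) → Holds β
-- At `b = true` the function reduces to `proj₁ ⟦ β ⟧`.
⇒-holds α β hα = trans (cong (λ b → not b Bool.∨ proj₁ ⟦ β ⟧) (sym hα))

contradiction-holds : ∀ {γ} → γ ∈ ｛ var 0 ｝ ∪ ｛ ¬ᶠ var 0 ｝ → Holds γ
contradiction-holds (inj₁ refl) = refl
contradiction-holds (inj₂ refl) = refl

∘var-fails : ∀ n → ¬ Holds (∘ var n)
∘var-fails n ()

theorem3p26 : Paraconsistent RC₁ⁱ²
-- The conclusion must lie outside the ultrafilter. A variable has value `p`, which is inside,
-- whereas `circ p` is the bottom element.
theorem3p26 = var 0 , ∘ var 0 , λ where
  (inj₁ ⊢ψ) → ∘var-fails 0 (cong proj₁ (RC₁ⁱ²-sound ⊢ψ))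
  (inj₂ (γs , γs∈Γ , ⊢⋀γs⇒ψ)) → ∘var-fails 0
    (⇒-holds (⋀ γs) (∘ var 0) (⋀-holds contradiction-holds γs γs∈Γ)
      (cong proj₁ (RC₁ⁱ²-sound ⊢⋀γs⇒ψ)))
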